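{- Let $f:\mathcal{C}\to\mathcal{D}$ be a morphism of codes. If $\mathcal{C}$ is intersection complete, then $f(\mathcal{C})$ is intersection complete. If $\mathcal{C}$ is max-intersection complete, then $f(\mathcal{C})$ is max-intersection complete.
   Context: A code is a subset $\mathcal{C}\subseteq 2^{[n]}$. For $\sigma\subseteq[n]$, $\mathrm{Tk}_{\mathcal{C}}(\sigma)=\{c\in\mathcal{C}\mid\sigma\subseteq c\}$; a trunk in $\mathcal{C}$ is a subset that is empty or of the form $\mathrm{Tk}_{\mathcal{C}}(\sigma)$. A function $f:\mathcal{C}\to\mathcal{D}$ between codes is a morphism if the preimage of every trunk in $\mathcal{D}$ is a trunk in $\mathcal{C}$. A code is intersection complete if $c_1\cap c_2\in\mathcal{C}$ for all $c_1,c_2\in\mathcal{C}$. A code is max-intersection complete if the intersection of any nonempty collection of maximal (under inclusion) codewords of $\mathcal{C}$ belongs to $\mathcal{C}$. -}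

module Defs where

open import Data.Bool using (Bool; true; false; T)
open import Data.Bool.Properties using () renaming (_≟_ to _≟ᵇ_)
open import Data.Fin.Subset using (Subset; _⊆_; _∩_; ⋂)
open import Data.Fin.Subset.Properties using (anySubset?)
open import Data.List using (List; [])
open import Data.List.Relation.Unary.All using (All)
open import Data.Nat using (ℕ)
open import Data.Product using (Σ; ∃; _×_; _,_; proj₁)
open import Data.Sum using (_⊎_)
open import Data.Vec.Properties using (≡-dec)
open import Function.Bundles using (_⇔_; mk⇔)
open import Level using (0ℓ)
open import Relation.Binary.PropositionalEquality using (_≡_; _≢_)
open import Relation.Nullary using (Dec; yes; no)
open import Relation.Nullary.Decidable using (⌊_⌋; toWitness; fromWitness)
open import Relation.Unary using (Pred; Empty; _≐_; _⊢_)

-- A code is given by its characteristic function.  Membership is thus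
-- decidable and proof-irrelevant, so that functions out of Codeword C are
-- exactly functions on the set of codewords.
Code : ℕ → Set
Code n = Subset n → Bool

infix 4 _∈ᶜ_

_∈ᶜ_ : ∀ {n} → Subset n → Code n → Set
c ∈ᶜ C = T (C c)

Codeword : ∀ {n} → Code n → Set
Codeword {n} C = Σ (Subset n) (_∈ᶜ C)

Tk : ∀ {n} (C : Code n) → Subset n → Pred (Codeword C) 0ℓ
Tk C σ c = σ ⊆ proj₁ c

IsTrunk : ∀ {n} (C : Code n) → Pred (Codeword C) 0ℓ → Set
IsTrunk C P = Empty P ⊎ ∃ λ σ → P ≐ Tk C σ

-- f ⊢ P is the preimage of P under f.
IsMorphism : ∀ {n m} (C : Code n) (D : Code m) → (Codeword C → Codeword D) → Set₁
IsMorphism C D f = (P : Pred (Codeword D) 0ℓ) → IsTrunk D P → IsTrunk C (f ⊢ P)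

IntersectionComplete : ∀ {n} → Code n → Set
IntersectionComplete C = ∀ c₁ c₂ → c₁ ∈ᶜ C → c₂ ∈ᶜ C → c₁ ∩ c₂ ∈ᶜ C

IsMaximal : ∀ {n} → Code n → Subset n → Set
IsMaximal C c = c ∈ᶜ C × (∀ d → d ∈ᶜ C → c ⊆ d → d ≡ c)

-- As 2^[n] is finite, every collection of codewords can be listed; ⋂ does not
-- depend on order or repetitions in the list.
MaxIntersectionComplete : ∀ {n} → Code n → Set
MaxIntersectionComplete {n} C =
  (cs : List (Subset n)) → cs ≢ [] → All (IsMaximal C) cs → ⋂ cs ∈ᶜ C

private
  Σ-T? : ∀ b {P : T b → Set} → (∀ p → Dec (P p)) → Dec (Σ (T b) P)
  Σ-T? false P? = no λ ()
  Σ-T? true  P? with P? _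
  ... | yes p = yes (_ , p)
  ... | no ¬p = no λ (_ , p) → ¬p p

module _ {n m} {C : Code n} {D : Code m} (f : Codeword C → Codeword D) where

  private
    Hits : Subset m → Subset n → Set
    Hits d c = Σ (c ∈ᶜ C) λ c∈C → proj₁ (f (c , c∈C)) ≡ d

    hits? : ∀ d c → Dec (Hits d c)
    hits? d c = Σ-T? (C c) λ c∈C → ≡-dec _≟ᵇ_ (proj₁ (f (c , c∈C))) d

  -- The code f(C); its characteristic function is found by searching 2^[n].
  image : Code m
  image d = ⌊ anySubset? (hits? d) ⌋

  ∈-image : ∀ d → d ∈ᶜ image ⇔ (∃ λ c → proj₁ (f c) ≡ d)
  ∈-image d = mk⇔
    (λ d∈ → let (c , c∈C , eq) = toWitness {a? = anySubset? (hits? d)} d∈ in (c , c∈C) , eq)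
    (λ ((c , c∈C) , eq) → fromWitness {a? = anySubset? (hits? d)} (c , c∈C , eq))

{-# OPTIONS --safe #-}
-- A morphism preserves every nonempty intersection that is a codeword.  If
-- c = x₁ ∩ … ∩ xₖ, the preimage of Tk_D(f x₁ ∩ … ∩ f xₖ) contains each xᵢ, so it
-- is Tk_C(σ) with σ contained in each xᵢ, hence in c; therefore
-- f x₁ ∩ … ∩ f xₖ ⊆ f c, and the converse is monotonicity.  In the max-intersection
-- complete case, a maximal codeword of f(C) is the image of a maximal codeword
-- of C, because any preimage can be enlarged to a maximal one.
module Submission where

open import Data.Bool.Properties using (T?)
open import Data.Empty using (⊥-elim)
open import Data.Fin.Subset using (Subset; _⊆_; _∩_; ⋂; _⊂_; _⊃_)
open import Data.Fin.Subset.Induction using (⊃-wellFounded)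
open import Data.Fin.Subset.Properties
open import Data.List using (List; []; _∷_; map)
open import Data.List.Relation.Unary.All as All using (All; []; _∷_)
open import Data.List.Relation.Unary.All.Properties using (map⁺; map⁻)
open import Data.Nat using (ℕ)
open import Data.Product using (∃; _×_; _,_; proj₁; proj₂)
open import Data.Sum using (inj₁; inj₂)
open import Defs
open import Function using (_∘_; id)
open import Function.Bundles using (Equivalence)
open import Induction.WellFounded using (Acc; acc)
open import Relation.Binary.PropositionalEquality
  using (_≡_; refl; sym; cong; cong₂; subst)
open import Relation.Nullary using (¬_; yes; no; contradiction)
open import Relation.Nullary.Decidable using (_×-dec_; decidable-stable)

⋂-lower : ∀ {n} (ps : List (Subset n)) → All (⋂ ps ⊆_) ps
⋂-lower []       = []
⋂-lower (p ∷ ps) =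
  p∩q⊆p p (⋂ ps) ∷
  All.map {P = ⋂ ps ⊆_} {Q = p ∩ ⋂ ps ⊆_}
    (λ ⋂ps⊆q → ⋂ps⊆q ∘ p∩q⊆q p (⋂ ps)) (⋂-lower ps)

⋂-greatest : ∀ {n} {q : Subset n} {ps} → All (q ⊆_) ps → q ⊆ ⋂ ps
⋂-greatest []             = λ _ → ∈⊤
⋂-greatest (q⊆p ∷ q⊆ps) = λ x∈q → x∈p∩q⁺ (q⊆p x∈q , ⋂-greatest q⊆ps x∈q)

-- `⋂` folds from the full set, so a two-element list leaves a trailing `∩ ⊤`; removing it lets the
-- binary case use the list version.
⋂-pair : ∀ {n} (p q : Subset n) → ⋂ (p ∷ q ∷ []) ≡ p ∩ q
⋂-pair p q = cong (p ∩_) (∩-identityʳ q)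

⊆∧⊄⇒⊇ : ∀ {n} {p q : Subset n} → p ⊆ q → ¬ (p ⊂ q) → q ⊆ p
⊆∧⊄⇒⊇ {p = p} p⊆q p⊄q {x} x∈q =
  decidable-stable (x ∈? p) λ x∉p → p⊄q (p⊆q , x , x∈q , x∉p)

module _ {n} (C : Code n) where

  -- Climbing through strictly larger codewords must stop, since `_⊃_` is well-founded on subsets of
  -- a finite set; where it stops, the codeword is maximal.
  maximal-above : ∀ {c} → c ∈ᶜ C → ∃ λ d → IsMaximal C d × c ⊆ d
  maximal-above = go (⊃-wellFounded _)
    where
    go : ∀ {c} → Acc _⊃_ c → c ∈ᶜ C → ∃ λ d → IsMaximal C d × c ⊆ d
    go {c} (acc rs) c∈C with anySubset? (λ d → T? (C d) ×-dec c ⊂? d)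
    ... | yes (d , d∈C , c⊂d) =
      let (e , e-max , d⊆e) = go (rs c⊂d) d∈C in e , e-max , d⊆e ∘ proj₁ c⊂d
    ... | no ∄d =
      c , (c∈C , λ d d∈C c⊆d →
             ⊆-antisym (⊆∧⊄⇒⊇ c⊆d λ c⊂d → ∄d (d , d∈C , c⊂d)) c⊆d)
        , id

module _ {n m} {C : Code n} {D : Code m} (f : Codeword C → Codeword D)
         (f-mor : IsMorphism C D f) where

  private
    f[C] : Code m
    f[C] = image {C = C} {D = D} f

    f∈ : ∀ c → proj₁ (f c) ∈ᶜ f[C]
    f∈ c = Equivalence.from (∈-image {C = C} {D = D} f _) (c , refl)

    f∈⁻ : ∀ {d} → d ∈ᶜ f[C] → ∃ λ c → proj₁ (f c) ≡ d
    f∈⁻ = Equivalence.to (∈-image {C = C} {D = D} f _)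

  -- The codeword `c` lies in the preimage of the trunk of `τ`, so this preimage is not the empty
  -- trunk and some `σ` defines it.
  preimage-Tk : ∀ {τ} c → τ ⊆ proj₁ (f c) → ∃ λ σ →
    ∀ x → (τ ⊆ proj₁ (f x) → σ ⊆ proj₁ x) × (σ ⊆ proj₁ x → τ ⊆ proj₁ (f x))
  preimage-Tk {τ} c τ⊆fc with f-mor (Tk D τ) (inj₂ (τ , id , id))
  ... | inj₁ empty           = ⊥-elim (empty c τ⊆fc)
  ... | inj₂ (σ , to , from) = σ , λ x → to {x} , from {x}

  -- Take `τ` to be the image of `x`: as `x` lies in the preimage of that trunk, `σ` is contained in
  -- `x`, hence in `y`.
  morphism-mono : ∀ x y → proj₁ x ⊆ proj₁ y → proj₁ (f x) ⊆ proj₁ (f y)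
  morphism-mono x y x⊆y =
    let (σ , iff) = preimage-Tk x id
    in proj₂ (iff y) (x⊆y ∘ proj₁ (iff x) id)

  morphism-⋂ : ∀ c x xs → proj₁ c ≡ ⋂ (map proj₁ (x ∷ xs)) →
               proj₁ (f c) ≡ ⋂ (map (proj₁ ∘ f) (x ∷ xs))
  morphism-⋂ c x xs c≡⋂ = ⊆-antisym
    (⋂-greatest (map⁺ (All.map (λ {y} → morphism-mono c y) c⊆xs)))
    (proj₂ (iff c) (subst (σ ⊆_) (sym c≡⋂) (⋂-greatest (map⁺ σ⊆xs))))
    where
    c⊆xs : All (λ y → proj₁ c ⊆ proj₁ y) (x ∷ xs)
    c⊆xs = map⁻ (subst (λ p → All (p ⊆_) (map proj₁ (x ∷ xs))) (sym c≡⋂) (⋂-lower _))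

    ⋂⊆fxs : All (λ y → ⋂ (map (proj₁ ∘ f) (x ∷ xs)) ⊆ proj₁ (f y)) (x ∷ xs)
    ⋂⊆fxs = map⁻ (⋂-lower _)

    -- Nonemptiness of the list matters here: its head shows that the preimage is inhabited.
    trunk = preimage-Tk x (All.head ⋂⊆fxs)
    σ     = proj₁ trunk
    iff   = proj₂ trunk

    σ⊆xs : All (λ y → σ ⊆ proj₁ y) (x ∷ xs)
    σ⊆xs = All.map (λ {y} → proj₁ (iff y)) ⋂⊆fxs

  -- Both completeness proofs reduce to this: the codeword sent to the intersection of the images is
  -- the intersection of the chosen preimages.
  ⋂-∈-image : ∀ x xs → ⋂ (map proj₁ (x ∷ xs)) ∈ᶜ C →
              ⋂ (map (proj₁ ∘ f) (x ∷ xs)) ∈ᶜ f[C]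
  ⋂-∈-image x xs ⋂∈C =
    subst (_∈ᶜ f[C]) (morphism-⋂ (_ , ⋂∈C) x xs refl) (f∈ _)

  image-intersectionComplete : IntersectionComplete C → IntersectionComplete f[C]
  image-intersectionComplete C-∩ d₁ d₂ d₁∈ d₂∈ with f∈⁻ d₁∈ | f∈⁻ d₂∈
  ... | x@(c₁ , c₁∈) , refl | y@(c₂ , c₂∈) , refl =
    subst (_∈ᶜ f[C]) (⋂-pair d₁ d₂)
      (⋂-∈-image x (y ∷ []) (subst (_∈ᶜ C) (sym (⋂-pair c₁ c₂)) (C-∩ c₁ c₂ c₁∈ c₂∈)))

  maximal-preimage : ∀ {d} → IsMaximal f[C] d →
                     ∃ λ x → IsMaximal C (proj₁ x) × proj₁ (f x) ≡ d
  maximal-preimage (d∈ , d-max) with f∈⁻ d∈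
  ... | x , refl =
    let (e , e-max , x⊆e) = maximal-above C (proj₂ x)
        y = e , proj₁ e-max
    -- Monotonicity puts `d` below the image of `y`, so maximality of `d` forces equality.
    in y , e-max , d-max _ (f∈ y) (morphism-mono x y x⊆e)

  -- Writing `ds` as a mapped list gives the form that `⋂-∈-image` expects.
  maximal-preimages : ∀ {ds} → All (IsMaximal f[C]) ds →
                      ∃ λ xs → All (IsMaximal C) (map proj₁ xs) × map (proj₁ ∘ f) xs ≡ ds
  maximal-preimages []       = [] , [] , refl
  maximal-preimages (p ∷ ps) =
    let (x  , x-max  , fx≡)  = maximal-preimage p
        (xs , xs-max , fxs≡) = maximal-preimages ps
    in x ∷ xs , x-max ∷ xs-max , cong₂ _∷_ fx≡ fxs≡

  image-maxIntersectionComplete : MaxIntersectionComplete C → MaxIntersectionComplete f[C]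
  image-maxIntersectionComplete C-⋂ ds ds≢[] ds-max with maximal-preimages ds-max
  ... | []     , _      , refl = contradiction refl ds≢[]
  ... | x ∷ xs , xs-max , refl = ⋂-∈-image x xs (C-⋂ _ (λ ()) xs-max)

theorem1p3 : ∀ {n m : ℕ} (C : Code n) (D : Code m) (f : Codeword C → Codeword D) →
    IsMorphism C D f →
    (IntersectionComplete C → IntersectionComplete (image {C = C} {D = D} f)) ×
    (MaxIntersectionComplete C → MaxIntersectionComplete (image {C = C} {D = D} f))
theorem1p3 C D f f-mor =
  image-intersectionComplete f f-mor , image-maxIntersectionComplete f f-mor
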